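{- Let $G$ be a connected chordal graph with at least two vertices. A vertex $v\in V(G)$ is an $\mathcal{L}$-branch leaf of some perfect elimination ordering of $G$ if and only if $v$ is simplicial in $G$.
   Context: Graphs are finite, simple, undirected. A graph is chordal if it has no induced cycle of length at least 4. A vertex is simplicial if its neighborhood is a clique. A vertex ordering $\sigma$ of $G$ (a bijection $\{1,\dots,n\}\to V(G)$, with $u\prec_\sigma w$ meaning $u$ comes before $w$) is a perfect elimination ordering (PEO) if every vertex $v$ is simplicial in the subgraph induced by $\{w : w\prec_\sigma v\}\cup\{v\}$, i.e., the neighbors of $v$ to its left form a clique. For an ordering $\sigma$ of a connected graph in which every vertex other than $\sigma(1)$ has a neighbor to its left (as is the case for PEOs of connected chordal graphs), the $\mathcal{L}$-tree of $\sigma$ is the spanning tree containing, for each $v\neq\sigma(1)$, the edge from $v$ to its rightmost neighbor $w$ with $w\prec_\sigma v$. A vertex $v\neq\sigma(1)$ that is a leaf of the $\mathcal{L}$-tree is an $\mathcal{L}$-branch leaf of $\sigma$. -}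

module Defs where

open import Level using (0ℓ) renaming (suc to lsuc)
open import Data.Nat.Base using (ℕ; suc; _≤_)
open import Data.Fin.Base using (Fin; toℕ) renaming (_<_ to _<ᶠ_; _≤_ to _≤ᶠ_)
open import Data.Fin.Properties using (all?; <-irrefl) renaming (_<?_ to _<ᶠ?_; _≤?_ to _≤ᶠ?_)
open import Data.Fin.Permutation using (Permutation′; _⟨$⟩ˡ_)
open import Data.Product using (_×_; _,_; ∃!)
open import Data.Sum.Base using (_⊎_; inj₁; inj₂; swap)
open import Function.Bundles using (_⇔_)
open import Function.Definitions using (Injective)
open import Relation.Binary.Core using (Rel)
open import Relation.Binary.Definitions using (Symmetric; Irreflexive; Decidable)
open import Relation.Binary.Construct.Closure.ReflexiveTransitive using (Star)
open import Relation.Binary.PropositionalEquality.Core using (_≡_; _≢_; refl)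
open import Relation.Nullary.Negation.Core using (¬_)
open import Relation.Nullary.Decidable.Core using (_×-dec_; _⊎-dec_; _→-dec_)
open import Relation.Unary using (Pred)

record Graph (n : ℕ) : Set (lsuc 0ℓ) where
  infix 4 _~_ _~?_
  field
    _~_      : Rel (Fin n) 0ℓ
    ~-sym    : Symmetric _~_
    ~-irrefl : Irreflexive _≡_ _~_
    _~?_     : Decidable _~_

-- Adjacency in the cycle 0, 1, …, k - 1, 0; used only for k ≥ 4.
CyclicSuccessor : ∀ {k} → Rel (Fin k) 0ℓ
CyclicSuccessor {k} i j =
  (toℕ j ≡ suc (toℕ i)) ⊎ (suc (toℕ i) ≡ k × toℕ j ≡ 0)

CyclicNeighbours : ∀ {k} → Rel (Fin k) 0ℓ
CyclicNeighbours i j = CyclicSuccessor i j ⊎ CyclicSuccessor j i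

-- Positions are the elements of Fin n, so that σ ⟨$⟩ʳ_ lists the vertices from
-- left to right and σ ⟨$⟩ˡ v is the position of v.
Ordering : ℕ → Set
Ordering = Permutation′

module _ {n : ℕ} where

  infix 4 _≺[_]_ _≼[_]_

  _≺[_]_ : Fin n → Ordering n → Fin n → Set
  u ≺[ σ ] w = (σ ⟨$⟩ˡ u) <ᶠ (σ ⟨$⟩ˡ w)

  _≼[_]_ : Fin n → Ordering n → Fin n → Set
  u ≼[ σ ] w = (σ ⟨$⟩ˡ u) ≤ᶠ (σ ⟨$⟩ˡ w)

  IsFirst : Ordering n → Fin n → Set
  IsFirst σ v = toℕ (σ ⟨$⟩ˡ v) ≡ 0

module _ {n : ℕ} (G : Graph n) where
  open Graph G

  Connected : Set
  Connected = ∀ u v → Star _~_ u v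

  InducedCycle : ∀ {k} → (Fin k → Fin n) → Set
  InducedCycle c =
    Injective _≡_ _≡_ c × (∀ i j → c i ~ c j ⇔ CyclicNeighbours i j)

  Chordal : Set
  Chordal = ∀ k → 4 ≤ k → (c : Fin k → Fin n) → ¬ InducedCycle c

  Clique : Pred (Fin n) 0ℓ → Set
  Clique S = ∀ u w → S u → S w → u ≢ w → u ~ w

  Simplicial : Fin n → Set
  Simplicial v = Clique (λ u → u ~ v)

  -- The neighbourhood of a vertex v in the subgraph induced by v and the
  -- vertices before it consists of the neighbours of v that come before v.
  PerfectEliminationOrdering : Ordering n → Set
  PerfectEliminationOrdering σ = ∀ v → Clique (λ u → u ≺[ σ ] v × u ~ v)

  RightmostLeftNeighbour : Ordering n → Fin n → Fin n → Set
  RightmostLeftNeighbour σ v w =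
    w ≺[ σ ] v × w ~ v × (∀ u → u ≺[ σ ] v → u ~ v → u ≼[ σ ] w)

  rightmostLeftNeighbour? : ∀ σ → Decidable (RightmostLeftNeighbour σ)
  rightmostLeftNeighbour? σ v w =
    ((σ ⟨$⟩ˡ w) <ᶠ? (σ ⟨$⟩ˡ v)) ×-dec (w ~? v) ×-dec
    all? (λ u → ((σ ⟨$⟩ˡ u) <ᶠ? (σ ⟨$⟩ˡ v)) →-dec
                ((u ~? v) →-dec ((σ ⟨$⟩ˡ u) ≤ᶠ? (σ ⟨$⟩ˡ w))))

  -- A spanning tree only when every vertex but the first has a neighbour to its
  -- left; for other orderings this is a spanning forest.  The first vertex has
  -- no left neighbour, so it needs no separate exclusion as v.
  𝓛-tree : Ordering n → Graph n
  𝓛-tree σ = record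
    { _~_      = λ v w → RightmostLeftNeighbour σ v w ⊎ RightmostLeftNeighbour σ w v
    ; ~-sym    = swap
    ; ~-irrefl = λ { refl (inj₁ (v≺v , _)) → <-irrefl refl v≺v
                   ; refl (inj₂ (v≺v , _)) → <-irrefl refl v≺v }
    ; _~?_     = λ v w → rightmostLeftNeighbour? σ v w ⊎-dec rightmostLeftNeighbour? σ w v
    }

  Leaf : Fin n → Set
  Leaf v = ∃! _≡_ (λ w → v ~ w)

module _ {n : ℕ} (G : Graph n) where

  𝓛-BranchLeaf : Ordering n → Fin n → Set
  𝓛-BranchLeaf σ v = ¬ IsFirst σ v × Leaf (𝓛-tree G σ) v

{-# OPTIONS --safe #-}
module Submission where

-- If v is an 𝓛-branch leaf of a PEO, then v has no right neighbour: the parent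
-- of a right neighbour of v would be a right neighbour of v closer to v, forever.
-- So N(v) consists of left neighbours and is a clique.
--
-- Conversely, append a simplicial v to a PEO of G ∖ v.  That chordal graphs have
-- PEOs rests on Dirac's theorem.  In a vertex set W that is not a clique, take a
-- maximal connected U whose closed neighbourhood does not cover W, and let F be
-- the uncovered part.  By maximality every boundary vertex of U is adjacent to
-- all of F, and two nonadjacent boundary vertices would close, through U and a
-- vertex of F, an induced cycle of length at least 4.  Hence a simplicial vertex
-- of F, which exists by induction, is simplicial in W.

open import Defs
open import Data.Nat.Base using (ℕ; zero; suc; _≤_; z≤n; s≤s)
open import Data.Nat.Properties using (suc-injective; <⇒≱; <⇒≯; <⇒≤; <-trans; n≢0⇒n>0)
open import Data.Fin.Base using (Fin; zero; suc; toℕ; fromℕ; punchIn; punchOut)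
  renaming (_<_ to _<ᶠ_; _≤_ to _≤ᶠ_)
open import Data.Fin.Properties as Fin using (toℕ-injective; toℕ-fromℕ; any?; punchIn-punchOut;
  punchIn-injective; punchIn-mono-≤; ≤fromℕ; <-irrefl; <-cmp) renaming (_<?_ to _<ᶠ?_)
open import Data.Fin.Induction using (<-wellFounded)
open import Data.Fin.Permutation as Perm using (_⟨$⟩ˡ_; _⟨$⟩ʳ_; insert; inverseˡ; inverseʳ)
open import Data.Fin.Subset using (Subset; _∈_; _∉_; _∪_; _⊂_; _⊃_; ⁅_⁆; ⊤; Nonempty)
open import Data.Fin.Subset.Properties using (_∈?_; ∈⊤; x∈⁅x⁆; x∈⁅y⁆⇒x≡y; x∈p∪q⁻; p⊆p∪q; q⊆p∪q)
open import Data.Fin.Subset.Induction using (⊂-wellFounded; ⊃-wellFounded)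
open import Data.Product.Base using (_×_; _,_; proj₁; proj₂; ∃; ∃-syntax)
open import Data.Sum.Base as Sum using (_⊎_; inj₁; inj₂; [_,_]′)
import Data.Unit.Base as Unit
open import Data.Vec.Base using (tabulate)
open import Data.Vec.Properties using (lookup⇒[]=; []=⇒lookup; lookup∘tabulate)
open import Data.Vec.Functional using (_∷_)
open import Function.Base using (_∘_)
open import Function.Bundles using (_⇔_; mk⇔; Equivalence)
open import Function.Definitions using (Injective)
open import Induction.WellFounded using (Acc; acc)
open import Relation.Binary.Construct.Closure.ReflexiveTransitive as Star using (Star; ε; _◅_; _◅◅_)
open import Relation.Binary.Definitions using (tri<; tri≈; tri>)
open import Relation.Binary.PropositionalEquality using (_≡_; _≢_; refl; sym; trans; cong;
  subst; subst₂)
open import Relation.Nullary.Decidable using (Dec; yes; no; does; dec-true; decidable-stable;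
  ¬?; _×-dec_; _⊎-dec_)
open import Relation.Nullary.Negation using (¬_; contradiction)
open import Relation.Unary using (Pred; Decidable)
open import Level using (0ℓ)

open Equivalence using (to; from)

private
  variable
    m n : ℕ

-- Subsets and maxima of decidable predicates on `Fin n`.

comprehension : {P : Pred (Fin n) 0ℓ} → Decidable P → Subset n
comprehension P? = tabulate (does ∘ P?)

module _ {P : Pred (Fin n) 0ℓ} (P? : Decidable P) where

  ∈-comprehension⁺ : ∀ {x} → P x → x ∈ comprehension P?
  ∈-comprehension⁺ {x} Px =
    lookup⇒[]= x _ (trans (lookup∘tabulate (does ∘ P?) x) (dec-true (P? x) Px))

  ∈-comprehension⁻ : ∀ {x} → x ∈ comprehension P? → P x
  ∈-comprehension⁻ {x} x∈ with P? x | trans (sym (lookup∘tabulate (does ∘ P?) x)) ([]=⇒lookup x∈)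
  ... | yes Px | _ = Px
  ... | no  _  | ()

greatest : {P : Pred (Fin n) 0ℓ} → Decidable P → ∃ P →
           ∃[ i ] (P i × (∀ j → P j → j ≤ᶠ i))
greatest {suc n} P? (i , Pi) with any? (P? ∘ suc)
... | yes later = let k , Pk , k-max = greatest (P? ∘ suc) later in
      suc k , Pk , λ { zero _ → z≤n ; (suc j) Pj → s≤s (k-max j Pj) }
greatest P? (zero  , P0) | no ¬later =
      zero , P0 , λ { zero _ → z≤n ; (suc j) Pj → contradiction (j , Pj) ¬later }
greatest P? (suc i , Pi) | no ¬later = contradiction (i , Pi) ¬later

-- Walks and induced paths.

module _ (G : Graph n) where
  open Graph G

  -- The predicate is carried by the steps, so an empty walk says nothing about its endpoint.
  Walk : Pred (Fin n) 0ℓ → Fin n → Fin n → Set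
  Walk P = Star (λ x y → x ~ y × P x × P y)

  Walk-sym : ∀ {P x y} → Walk P x y → Walk P y x
  Walk-sym = Star.reverse λ (x~y , Px , Py) → ~-sym x~y , Py , Px

  Walk-mono : ∀ {P Q : Pred (Fin n) 0ℓ} → (∀ {x} → P x → Q x) → ∀ {x y} → Walk P x y → Walk Q x y
  Walk-mono P⊆Q = Star.map λ (x~y , Px , Py) → x~y , P⊆Q Px , P⊆Q Py

  Consecutive : Fin m → Fin m → Set
  Consecutive i j = toℕ j ≡ suc (toℕ i) ⊎ toℕ i ≡ suc (toℕ j)

  InducedPath : (Fin m → Fin n) → Set
  InducedPath p = Injective _≡_ _≡_ p × (∀ i j → p i ~ p j ⇔ Consecutive i j)

  InducedPath-tail : (p : Fin (suc m) → Fin n) → InducedPath p → InducedPath (p ∘ suc)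
  InducedPath-tail p (inj , adj) =
    (λ eq → Fin.suc-injective (inj eq)) ,
    λ i j → mk⇔ (Sum.map suc-injective suc-injective ∘ to (adj (suc i) (suc j)))
                (from (adj (suc i) (suc j)) ∘ Sum.map (cong suc) (cong suc))

  InducedPath-∷ : ∀ {x} (p : Fin (suc m) → Fin n) → InducedPath p → x ~ p zero →
    (∀ i → x ≢ p i) → (∀ i → ¬ x ~ p (suc i)) → InducedPath (x ∷ p)
  InducedPath-∷ {x = x} p (inj , adj) x~p₀ x≢p x≁p = inj′ , adj′
    where
    inj′ : Injective _≡_ _≡_ (x ∷ p)
    inj′ {zero}  {zero}  _  = refl
    inj′ {zero}  {suc j} eq = contradiction eq (x≢p j)
    inj′ {suc i} {zero}  eq = contradiction (sym eq) (x≢p i)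
    inj′ {suc i} {suc j} eq = cong suc (inj eq)

    adj′ : ∀ i j → (x ∷ p) i ~ (x ∷ p) j ⇔ Consecutive i j
    adj′ zero zero = mk⇔ (λ x~x → contradiction x~x (~-irrefl refl)) [ (λ ()) , (λ ()) ]′
    adj′ zero (suc zero) = mk⇔ (λ _ → inj₁ refl) (λ _ → x~p₀)
    adj′ zero (suc (suc j)) = mk⇔ (λ x~p → contradiction x~p (x≁p j)) [ (λ ()) , (λ ()) ]′
    adj′ (suc zero) zero = mk⇔ (λ _ → inj₂ refl) (λ _ → ~-sym x~p₀)
    adj′ (suc (suc i)) zero = mk⇔ (λ p~x → contradiction (~-sym p~x) (x≁p i)) [ (λ ()) , (λ ()) ]′
    adj′ (suc i) (suc j) =
      mk⇔ (Sum.map (cong suc) (cong suc) ∘ to (adj i j))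
          (from (adj i j) ∘ Sum.map suc-injective suc-injective)

  record InducedPathFromTo (P : Pred (Fin n) 0ℓ) (x z : Fin n) : Set where
    constructor inducedPath
    field
      {size}  : ℕ
      path    : Fin (suc size) → Fin n
      induced : InducedPath path
      start   : path zero ≡ x
      end     : path (fromℕ size) ≡ z
      inside  : ∀ i → P (path i)

  Touches : Fin n → Fin n → Set
  Touches x y = x ~ y ⊎ x ≡ y

  touches? : ∀ x y → Dec (Touches x y)
  touches? x y = (x ~? y) ⊎-dec (x Fin.≟ y)

  -- Cutting the path at its last vertex touching x keeps it induced.
  reattach : ∀ {P x} → P x → (p : Fin (suc m) → Fin n) → InducedPath p → (∀ i → P (p i)) →
    ∃[ i ] Touches x (p i) → InducedPathFromTo P x (p (fromℕ m))
  reattach {x = x} Px p ind inP touch with any? (λ i → touches? x (p (suc i)))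
  reattach {m = zero}  Px p ind inP touch | yes (() , _)
  reattach {m = suc m} Px p ind inP touch | yes later =
    reattach Px (p ∘ suc) (InducedPath-tail p ind) (inP ∘ suc) later
  reattach Px p ind inP (suc i , t)         | no ¬later = contradiction (i , t) ¬later
  reattach Px p ind inP (zero  , inj₂ x≡p₀) | no ¬later = inducedPath p ind (sym x≡p₀) refl inP
  reattach {x = x} Px p ind inP (zero  , inj₁ x~p₀) | no ¬later =
    inducedPath (x ∷ p)
      (InducedPath-∷ p ind x~p₀
        (λ { zero x≡p₀ → ~-irrefl x≡p₀ x~p₀ ; (suc i) x≡p → ¬later (i , inj₂ x≡p) })
        (λ i x~p → ¬later (i , inj₁ x~p)))
      refl refl (λ { zero → Px ; (suc i) → inP i })

  -- Built from the far end: each earlier vertex is reattached to the induced path already found.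
  -- `P z` is asked for separately because the empty walk does not supply it.
  Walk⇒InducedPath : ∀ {P x z} → P z → Walk P x z → InducedPathFromTo P x z
  Walk⇒InducedPath {z = z} Pz ε = inducedPath {size = 0} (λ _ → z)
    ((λ { {zero} {zero} _ → refl }) ,
     λ { zero zero → mk⇔ (λ z~z → contradiction z~z (~-irrefl refl)) [ (λ ()) , (λ ()) ]′ })
    refl refl (λ _ → Pz)
  Walk⇒InducedPath Pz ((x~y , Px , _) ◅ walk) with Walk⇒InducedPath Pz walk
  ... | inducedPath p ind refl refl inP = reattach Px p ind inP (zero , inj₁ x~y)

  -- Induced cycles and chords.

  InducedPath-close : ∀ {w} (p : Fin (suc m) → Fin n) → InducedPath p → (∀ i → w ≢ p i) →
    (∀ i → w ~ p i ⇔ (i ≡ zero ⊎ i ≡ fromℕ m)) → InducedCycle G (w ∷ p)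
  InducedPath-close {m = m} {w} p (inj , adj) w≢p w~p = inj′ , adj′
    where
    inj′ : Injective _≡_ _≡_ (w ∷ p)
    inj′ {zero}  {zero}  _  = refl
    inj′ {zero}  {suc j} eq = contradiction eq (w≢p j)
    inj′ {suc i} {zero}  eq = contradiction (sym eq) (w≢p i)
    inj′ {suc i} {suc j} eq = cong suc (inj eq)

    ends⇔ : ∀ i → (i ≡ zero ⊎ i ≡ fromℕ m) ⇔ CyclicNeighbours {suc (suc m)} zero (suc i)
    ends⇔ i = mk⇔
      [ (λ { refl → inj₁ (inj₁ refl) })
      -- The new vertex has index 0 in a cycle of length `m + 2`; the last path vertex moves to
      -- index `m + 1` and so wraps around to it.
      , (λ { refl → inj₂ (inj₂ (cong (λ k → suc (suc k)) (toℕ-fromℕ m) , refl)) }) ]′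
      λ { (inj₁ (inj₁ eq)) → inj₁ (toℕ-injective (suc-injective eq))
        ; (inj₁ (inj₂ ()))
        ; (inj₂ (inj₁ ()))
        ; (inj₂ (inj₂ (eq , _))) → inj₂ (toℕ-injective
            (trans (suc-injective (suc-injective eq)) (sym (toℕ-fromℕ m)))) }

    adj′ : ∀ i j → (w ∷ p) i ~ (w ∷ p) j ⇔ CyclicNeighbours i j
    adj′ zero zero = mk⇔ (λ w~w → contradiction w~w (~-irrefl refl))
      λ { (inj₁ (inj₁ ())) ; (inj₁ (inj₂ ())) ; (inj₂ (inj₁ ())) ; (inj₂ (inj₂ ())) }
    adj′ zero (suc j) = mk⇔ (to (ends⇔ j) ∘ to (w~p j)) (from (w~p j) ∘ from (ends⇔ j))
    adj′ (suc i) zero = mk⇔ (Sum.swap ∘ to (ends⇔ i) ∘ to (w~p i) ∘ ~-sym)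
                            (~-sym ∘ from (w~p i) ∘ from (ends⇔ i) ∘ Sum.swap)
    adj′ (suc i) (suc j) = mk⇔
      (Sum.map (inj₁ ∘ cong suc) (inj₁ ∘ cong suc) ∘ to (adj i j))
      λ { (inj₁ (inj₁ eq)) → from (adj i j) (inj₁ (suc-injective eq))
        ; (inj₁ (inj₂ (_ , ())))
        ; (inj₂ (inj₁ eq)) → from (adj i j) (inj₂ (suc-injective eq))
        ; (inj₂ (inj₂ (_ , ()))) }

  module _ (chordal : Chordal G) where

    -- If `a` and `b` were nonadjacent, an induced path between them inside the allowed set would
    -- have at least three vertices and would meet the neighbourhood of `w` only in its ends, so `w`
    -- would close it into an induced cycle that chordality forbids.
    chord : ∀ {w a b} → w ~ a → w ~ b → a ≢ b →
      Walk (λ x → (x ≡ a ⊎ x ≡ b) ⊎ (w ≢ x × ¬ w ~ x)) a b → a ~ b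
    chord {w} {a} {b} w~a w~b a≢b walk =
      decidable-stable (a ~? b) (λ a≁b → impossible a≁b (Walk⇒InducedPath (inj₁ (inj₂ refl)) walk))
      where
      impossible : ¬ a ~ b → ¬ InducedPathFromTo _ a b
      impossible a≁b (inducedPath {zero} p _ start end _) = a≢b (trans (sym start) end)
      impossible a≁b (inducedPath {suc zero} p (_ , adj) start end _) =
        a≁b (subst₂ _~_ start end (from (adj zero (suc zero)) (inj₁ refl)))
      impossible a≁b (inducedPath {suc (suc m)} p ind@(inj , _) start end inside) =
        -- The path has `m + 3` vertices; together with `w` the cycle has length `m + 4`.
        chordal _ (s≤s (s≤s (s≤s (s≤s z≤n)))) (w ∷ p) (InducedPath-close p ind w≢p w~p)
        where
        w≢p : ∀ i → w ≢ p i
        w≢p i w≡pᵢ with inside i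
        ... | inj₁ (inj₁ pᵢ≡a) = ~-irrefl (trans w≡pᵢ pᵢ≡a) w~a
        ... | inj₁ (inj₂ pᵢ≡b) = ~-irrefl (trans w≡pᵢ pᵢ≡b) w~b
        ... | inj₂ (w≢pᵢ , _)  = w≢pᵢ w≡pᵢ

        w~p : ∀ i → w ~ p i ⇔ (i ≡ zero ⊎ i ≡ fromℕ (suc (suc m)))
        w~p i = mk⇔ (end-of (inside i))
          [ (λ { refl → subst (w ~_) (sym start) w~a }) , (λ { refl → subst (w ~_) (sym end) w~b }) ]′
          where
          end-of : (p i ≡ a ⊎ p i ≡ b) ⊎ (w ≢ p i × ¬ w ~ p i) → w ~ p i →
                   i ≡ zero ⊎ i ≡ fromℕ (suc (suc m))
          end-of (inj₁ (inj₁ pᵢ≡a)) _ = inj₁ (inj (trans pᵢ≡a (sym start)))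
          end-of (inj₁ (inj₂ pᵢ≡b)) _ = inj₂ (inj (trans pᵢ≡b (sym end)))
          end-of (inj₂ (_ , w≁pᵢ)) w~pᵢ = contradiction w~pᵢ w≁pᵢ

  -- Dirac's theorem: simplicial vertices of chordal graphs.

  Boundary : Subset n → Pred (Fin n) 0ℓ
  Boundary U x = ∃[ u ] (u ∈ U × u ~ x)

  boundary? : ∀ U → Decidable (Boundary U)
  boundary? U x = any? (λ u → (u ∈? U) ×-dec (u ~? x))

  -- `Boundary U` may contain vertices of `U` itself but need not contain all of them, so the closed
  -- neighbourhood of `U` is excluded by two separate conditions.
  Far : Subset n → Subset n → Pred (Fin n) 0ℓ
  Far W U x = x ∈ W × x ∉ U × ¬ Boundary U x

  far? : ∀ W U → Decidable (Far W U)
  far? W U x = (x ∈? W) ×-dec (¬? (x ∈? U)) ×-dec (¬? (boundary? U x))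

  ConnectedFrom : Fin n → Subset n → Set
  ConnectedFrom r U = ∀ {x} → x ∈ U → Walk (_∈ U) r x

  ConnectedFrom-∪ : ∀ {r U b} → ConnectedFrom r U → Boundary U b → ConnectedFrom r (U ∪ ⁅ b ⁆)
  ConnectedFrom-∪ {r} {U} {b} conn (u , u∈U , u~b) x∈U∪b with x∈p∪q⁻ U ⁅ b ⁆ x∈U∪b
  ... | inj₁ x∈U = Walk-mono (p⊆p∪q ⁅ b ⁆) (conn x∈U)
  ... | inj₂ x∈b with refl ← x∈⁅y⁆⇒x≡y b x∈b =
    Walk-mono (p⊆p∪q ⁅ b ⁆) (conn u∈U) ◅◅ (u~b , p⊆p∪q ⁅ b ⁆ u∈U , x∈U∪b) ◅ ε

  -- The neighbours of `a` and `b` in `U` are joined through the root.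
  ConnectedFrom-walk : ∀ {r U a b} → ConnectedFrom r U → Boundary U a → Boundary U b →
    Walk (λ x → (x ≡ a ⊎ x ≡ b) ⊎ x ∈ U) a b
  ConnectedFrom-walk conn (u , u∈U , u~a) (v , v∈U , v~b) =
    (~-sym u~a , inj₁ (inj₁ refl) , inj₂ u∈U) ◅
    (Walk-mono inj₂ (Walk-sym (conn u∈U) ◅◅ conn v∈U) ◅◅
    (v~b , inj₂ v∈U , inj₁ (inj₂ refl)) ◅ ε)

  -- Maximality enters only through `complete`: a boundary vertex nonadjacent to some far vertex
  -- could be added to `U` while that vertex stays far. Only the far part is confined to `W`; `U`
  -- may leave it.
  record MaximalConnected (W : Subset n) (r : Fin n) : Set where
    field
      U         : Subset n
      root      : r ∈ U
      connected : ConnectedFrom r U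
      far       : ∃ (Far W U)
      complete  : ∀ {b w} → b ∉ U → Boundary U b → Far W U w → b ~ w

  maximise : ∀ {W r} U → Acc _⊃_ U → r ∈ U → ConnectedFrom r U → ∃ (Far W U) → MaximalConnected W r
  maximise {W} {r} U (acc rec) r∈U conn far
    with any? (λ b → (¬? (b ∈? U)) ×-dec (boundary? U b) ×-dec
                     any? (λ w → far? W U w ×-dec (¬? (b ~? w))))
  ... | yes (b , b∉U , ∂b , w , (w∈W , w∉U , ¬∂w) , b≁w) =
    -- The set grows strictly, and `w` stays far: it differs from `b`, being off the boundary, and
    -- is not adjacent to `b`.
    maximise (U ∪ ⁅ b ⁆) (rec (p⊆p∪q ⁅ b ⁆ , b , q⊆p∪q U ⁅ b ⁆ (x∈⁅x⁆ b) , b∉U))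
      (p⊆p∪q ⁅ b ⁆ r∈U) (ConnectedFrom-∪ conn ∂b)
      (w , w∈W , [ w∉U , w∉b ∘ x∈⁅y⁆⇒x≡y b ]′ ∘ x∈p∪q⁻ U ⁅ b ⁆ ,
       λ (u , u∈U∪b , u~w) →
         [ (λ u∈U → ¬∂w (u , u∈U , u~w))
         , (λ u∈b → b≁w (subst (_~ w) (x∈⁅y⁆⇒x≡y b u∈b) u~w)) ]′ (x∈p∪q⁻ U ⁅ b ⁆ u∈U∪b))
    where
    w∉b : w ≢ b
    w∉b refl = ¬∂w ∂b
  ... | no ¬extend = record
    { U = U ; root = r∈U ; connected = conn ; far = far
    ; complete = λ {b} {w} b∉U ∂b farw →
        decidable-stable (b ~? w) λ b≁w → ¬extend (b , b∉U , ∂b , w , farw , b≁w) }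

  SimplicialIn : Subset n → Pred (Fin n) 0ℓ
  SimplicialIn W v = v ∈ W × Clique G (λ u → u ∈ W × u ~ v)

  module _ (chordal : Chordal G) where

    -- A neighbour of `v` in `W` is far or on the boundary, since a neighbour in `U` would put `v`
    -- on the boundary. Two far neighbours are adjacent by hypothesis, a far and a boundary one by
    -- `complete`, and two boundary ones by `chord`.
    Far-simplicial : ∀ {W r} (M : MaximalConnected W r) → let open MaximalConnected M in
      ∀ {v} → SimplicialIn (comprehension (far? W U)) v → SimplicialIn W v
    Far-simplicial {W} M {v} (v∈far , clique) = proj₁ farv , clique′
      where
      open MaximalConnected M
      farv = ∈-comprehension⁻ (far? W U) v∈far

      kind : ∀ {u} → u ∈ W → u ~ v → Far W U u ⊎ (u ∉ U × Boundary U u)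
      kind {u} u∈W u~v with u∉U ← (λ u∈U → proj₂ (proj₂ farv) (u , u∈U , u~v)) | boundary? U u
      ... | yes ∂u = inj₂ (u∉U , ∂u)
      ... | no ¬∂u = inj₁ (u∈W , u∉U , ¬∂u)

      far-from-v : ∀ {x} → x ∈ U → v ≢ x × ¬ v ~ x
      far-from-v x∈U = (λ { refl → proj₁ (proj₂ farv) x∈U }) ,
                       (λ v~x → proj₂ (proj₂ farv) (_ , x∈U , ~-sym v~x))

      clique′ : Clique G (λ u → u ∈ W × u ~ v)
      clique′ a b (a∈W , a~v) (b∈W , b~v) a≢b with kind a∈W a~v | kind b∈W b~v
      ... | inj₁ fa | inj₁ fb =
        clique a b (∈-comprehension⁺ (far? W U) fa , a~v) (∈-comprehension⁺ (far? W U) fb , b~v) a≢b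
      ... | inj₁ fa | inj₂ (b∉U , ∂b) = ~-sym (complete b∉U ∂b fa)
      ... | inj₂ (a∉U , ∂a) | inj₁ fb = complete a∉U ∂a fb
      -- `v` is the apex for `chord`: it lies outside `U` and has no neighbour there, so the walk
      -- through `U` is allowed.
      ... | inj₂ (_ , ∂a) | inj₂ (_ , ∂b) = chord chordal (~-sym a~v) (~-sym b~v) a≢b
              (Walk-mono (Sum.map₂ far-from-v) (ConnectedFrom-walk connected ∂a ∂b))

    simplicialIn-exists : ∀ W → Acc _⊂_ W → Nonempty W → ∃ (SimplicialIn W)
    simplicialIn-exists W (acc rec) (v , v∈W)
      with any? (λ x → (x ∈? W) ×-dec
             any? (λ y → (y ∈? W) ×-dec (¬? (x Fin.≟ y)) ×-dec (¬? (x ~? y))))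
    ... | no complete = v , v∈W , λ a b (a∈W , _) (b∈W , _) a≢b →
          decidable-stable (a ~? b) (λ a≁b → complete (a , a∈W , b , b∈W , a≢b , a≁b))
    ... | yes (x , x∈W , y , y∈W , x≢y , x≁y) =
          let s , s-simplicial = simplicialIn-exists W′
                -- The far part is a proper subset of `W`: it misses `x`, the root of `U`.
                (rec (proj₁ ∘ ∈-comprehension⁻ (far? W U) , x , x∈W ,
                      λ x∈W′ → proj₁ (proj₂ (∈-comprehension⁻ (far? W U) x∈W′)) root))
                (proj₁ far , ∈-comprehension⁺ (far? W U) (proj₂ far))
          in s , Far-simplicial M s-simplicial
      where
      fromSingleton : ∀ {u} → u ∈ ⁅ x ⁆ → u ≡ x
      fromSingleton = x∈⁅y⁆⇒x≡y x

      connected₀ : ConnectedFrom x ⁅ x ⁆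
      connected₀ u∈x with refl ← fromSingleton u∈x = ε

      M : MaximalConnected W x
      -- The start is admissible because `y`, distinct from `x` and not adjacent to it, is far.
      M = maximise ⁅ x ⁆ (⊃-wellFounded _) (x∈⁅x⁆ x) connected₀
        (y , y∈W , (λ y∈x → x≢y (sym (fromSingleton y∈x))) ,
         λ (u , u∈x , u~y) → x≁y (subst (_~ y) (fromSingleton u∈x) u~y))
      open MaximalConnected M
      W′ = comprehension (far? W U)

simplicial-exists : (G : Graph (suc n)) → Chordal G → ∃ (Simplicial G)
simplicial-exists G chordal =
  let v , _ , clique = simplicialIn-exists G chordal ⊤ (⊂-wellFounded ⊤) (zero , ∈⊤)
  in v , λ a b a~v b~v → clique a b (∈⊤ , a~v) (∈⊤ , b~v)

-- Deleting a vertex and appending it to an ordering.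

infixl 6 _∖_

_∖_ : Graph (suc n) → Fin (suc n) → Graph n
G ∖ v = record
  { _~_      = λ x y → punchIn v x ~ punchIn v y
  ; ~-sym    = ~-sym
  ; ~-irrefl = λ { refl → ~-irrefl refl }
  ; _~?_     = λ x y → punchIn v x ~? punchIn v y
  } where open Graph G

∖-chordal : (G : Graph (suc n)) (v : Fin (suc n)) → Chordal G → Chordal (G ∖ v)
∖-chordal G v chordal k 4≤k c (inj , adj) =
  chordal k 4≤k (punchIn v ∘ c) ((λ eq → inj (punchIn-injective v _ _ eq)) , adj)

infixl 5 _▹_

_▹_ : Ordering n → Fin (suc n) → Ordering (suc n)
σ ▹ v = insert (fromℕ _) v σ

module _ (σ : Ordering n) (v : Fin (suc n)) where

  ▹-last : (σ ▹ v) ⟨$⟩ˡ v ≡ fromℕ n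
  ▹-last with v Fin.≟ v
  ... | yes _  = refl
  ... | no v≢v = contradiction refl v≢v

  -- Obtained by inverting the map from positions to vertices, on which `insert` is computed.
  ▹-punchIn : ∀ k → (σ ▹ v) ⟨$⟩ˡ punchIn v k ≡ punchIn (fromℕ n) (σ ⟨$⟩ˡ k)
  ▹-punchIn k = trans (cong ((σ ▹ v) ⟨$⟩ˡ_) (sym to-punchIn)) (inverseˡ (σ ▹ v))
    where
    to-punchIn : (σ ▹ v) ⟨$⟩ʳ punchIn (fromℕ n) (σ ⟨$⟩ˡ k) ≡ punchIn v k
    to-punchIn = trans (Perm.insert-punchIn (fromℕ n) v σ (σ ⟨$⟩ˡ k)) (cong (punchIn v) (inverseʳ σ))

  -- `punchIn` preserves `≤`, so if `y` were at or before `x` in `σ`, it would remain so after the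
  -- insertion.
  ▹-≺⁻ : ∀ {x y} → punchIn v x ≺[ σ ▹ v ] punchIn v y → x ≺[ σ ] y
  ▹-≺⁻ {x} {y} x≺y with <-cmp (σ ⟨$⟩ˡ x) (σ ⟨$⟩ˡ y)
  ... | tri< lt _ _ = lt
  ... | tri≈ _ eq _ = contradiction (subst₂ _<ᶠ_
    (▹-punchIn x) (trans (▹-punchIn y) (cong (punchIn (fromℕ n)) (sym eq))) x≺y) (<-irrefl refl)
  ... | tri> _ _ gt = contradiction (punchIn-mono-≤ (fromℕ n) _ _ (<⇒≤ gt))
                        (<⇒≱ (subst₂ _<ᶠ_ (▹-punchIn x) (▹-punchIn y) x≺y))

  ▹-⊀ : ∀ u → ¬ v ≺[ σ ▹ v ] u
  ▹-⊀ u v≺u = <⇒≱ v≺u (subst (((σ ▹ v) ⟨$⟩ˡ u) ≤ᶠ_) (sym ▹-last) (≤fromℕ _))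

punchIn-or-equal : (v u : Fin (suc n)) → v ≡ u ⊎ ∃[ k ] punchIn v k ≡ u
punchIn-or-equal v u with v Fin.≟ u
... | yes v≡u = inj₁ v≡u
... | no  v≢u = inj₂ (punchOut v≢u , punchIn-punchOut v≢u)

-- Being last, `v` is a left neighbour of no vertex. The condition at `v` is simpliciality, and at
-- every other vertex it is inherited from `σ`.
▹-PEO : (G : Graph (suc n)) {v : Fin (suc n)} {σ : Ordering n} → Simplicial G v →
  PerfectEliminationOrdering (G ∖ v) σ → PerfectEliminationOrdering G (σ ▹ v)
▹-PEO G {v} {σ} simplicial peo x a b (a≺x , a~x) (b≺x , b~x) a≢b with punchIn-or-equal v x
... | inj₁ refl = simplicial a b a~x b~x a≢b
... | inj₂ (x′ , refl) with punchIn-or-equal v a | punchIn-or-equal v b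
...   | inj₁ refl | _ = contradiction a≺x (▹-⊀ σ v x)
...   | inj₂ _ | inj₁ refl = contradiction b≺x (▹-⊀ σ v x)
...   | inj₂ (a′ , refl) | inj₂ (b′ , refl) =
  peo x′ a′ b′ (▹-≺⁻ σ v a≺x , a~x) (▹-≺⁻ σ v b≺x , b~x) (a≢b ∘ cong (punchIn v))

PEO-exists : (G : Graph n) → Chordal G → ∃ (PerfectEliminationOrdering G)
PEO-exists {zero}  G chordal = Perm.id , λ ()
PEO-exists {suc n} G chordal =
  let v , simplicial = simplicial-exists G chordal
      σ , peo = PEO-exists (G ∖ v) (∖-chordal G v chordal)
  in σ ▹ v , ▹-PEO G simplicial peo

-- Parents and children in the `𝓛-tree`.

module _ (G : Graph n) (σ : Ordering n) where
  open Graph G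

  rightmostLeftNeighbour-exists : ∀ {u v} → u ≺[ σ ] v → u ~ v → ∃ (RightmostLeftNeighbour G σ v)
  rightmostLeftNeighbour-exists {u} {v} u≺v u~v =
    -- The maximum is taken over positions, not vertices: there the order of `Fin n` is the order of
    -- `σ`.
    let i , (i< , i~v) , i-max = greatest
          (λ i → (i <ᶠ? (σ ⟨$⟩ˡ v)) ×-dec ((σ ⟨$⟩ʳ i) ~? v))
          (σ ⟨$⟩ˡ u , u≺v , subst (_~ v) (sym (inverseʳ σ)) u~v)
    in σ ⟨$⟩ʳ i , subst (_<ᶠ _) (sym (inverseˡ σ)) i< , i~v ,
       λ x x≺v x~v → subst (_ ≤ᶠ_) (sym (inverseˡ σ))
         (i-max (σ ⟨$⟩ˡ x) (x≺v , subst (_~ v) (sym (inverseʳ σ)) x~v))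

  position-injective : ∀ {u w} → σ ⟨$⟩ˡ u ≡ σ ⟨$⟩ˡ w → u ≡ w
  position-injective eq = trans (sym (inverseʳ σ)) (trans (cong (σ ⟨$⟩ʳ_) eq) (inverseʳ σ))

  rightmostLeftNeighbour-unique : ∀ {v w w′} → RightmostLeftNeighbour G σ v w →
    RightmostLeftNeighbour G σ v w′ → w ≡ w′
  rightmostLeftNeighbour-unique (w≺v , w~v , w-max) (w′≺v , w′~v , w′-max) =
    position-injective (Fin.≤-antisym (w′-max _ w≺v w~v) (w-max _ w′≺v w′~v))

  -- Suppose `w` is a right neighbour of `v`, with parent `p`. Then `p` is not `v`, so it lies
  -- strictly between `v` and `w`; as left neighbours of `w`, `v` and `p` are adjacent. Thus `p` is
  -- a right neighbour of `v` at a smaller position, and the descent is well-founded.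
  childless⇒last : PerfectEliminationOrdering G σ → ∀ {v} →
    (∀ w → ¬ RightmostLeftNeighbour G σ w v) → ∀ {w} → v ~ w → ¬ v ≺[ σ ] w
  childless⇒last peo {v} childless v~w = descend (<-wellFounded _) v~w
    where
    descend : ∀ {w} → Acc _<ᶠ_ (σ ⟨$⟩ˡ w) → v ~ w → ¬ v ≺[ σ ] w
    descend {w} (acc rec) v~w v≺w with rightmostLeftNeighbour-exists v≺w v~w
    ... | p , rln@(p≺w , p~w , p-max) with v Fin.≟ p
    ...   | yes refl = childless w rln
    ...   | no v≢p = descend (rec p≺w)
              (peo w v p (v≺w , v~w) (p≺w , p~w) v≢p)
              (Fin.≤∧≢⇒< (p-max v v≺w v~w) (v≢p ∘ position-injective))

  ≺-total : ∀ {u w} → u ≢ w → u ≺[ σ ] w ⊎ w ≺[ σ ] u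
  ≺-total {u} {w} u≢w with <-cmp (σ ⟨$⟩ˡ u) (σ ⟨$⟩ˡ w)
  ... | tri< lt _ _ = inj₁ lt
  ... | tri≈ _ eq _ = contradiction (position-injective eq) u≢w
  ... | tri> _ _ gt = inj₂ gt

  -- An induced path that starts rightwards never turns back, since at the turn
  -- two left neighbours would be nonadjacent.
  InducedPath-rightwards : PerfectEliminationOrdering G σ → (p : Fin (suc (suc m)) → Fin n) →
    InducedPath G p → p zero ≺[ σ ] p (suc zero) → p zero ≺[ σ ] p (fromℕ (suc m))
  InducedPath-rightwards {m = zero}  _   p _ p₀≺p₁ = p₀≺p₁
  InducedPath-rightwards {m = suc m} peo p ind@(inj , adj) p₀≺p₁
    with ≺-total {p (suc zero)} {p (suc (suc zero))} (λ eq → contradiction (inj eq) λ ())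
  ... | inj₁ p₁≺p₂ = <-trans p₀≺p₁ (InducedPath-rightwards peo (p ∘ suc) (InducedPath-tail G p ind) p₁≺p₂)
  ... | inj₂ p₂≺p₁ = contradiction
    (to (adj zero (suc (suc zero)))
      (peo (p (suc zero)) (p zero) (p (suc (suc zero)))
        (p₀≺p₁ , from (adj zero (suc zero)) (inj₁ refl))
        (p₂≺p₁ , from (adj (suc (suc zero)) (suc zero)) (inj₂ refl))
        (λ eq → contradiction (inj eq) λ ())))
    [ (λ ()) , (λ ()) ]′

  -- Connectedness gives an induced path from `v` to `u`. Were its first step to the right, its end
  -- `u` would come after `v`; so its second vertex is a left neighbour of `v`.
  leftNeighbour-exists : Connected G → PerfectEliminationOrdering G σ → ∀ {u v} → u ≺[ σ ] v →
    ∃[ w ] (w ≺[ σ ] v × w ~ v)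
  leftNeighbour-exists conn peo {u} {v} u≺v
    with Walk⇒InducedPath G {P = λ _ → Unit.⊤} _ (Star.map (λ x~y → x~y , _ , _) (conn v u))
  ... | inducedPath {zero} p _ refl refl _ = contradiction u≺v (<-irrefl refl)
  ... | inducedPath {suc m} p ind@(inj , adj) refl refl _
    with ≺-total {p zero} {p (suc zero)} (λ eq → contradiction (inj eq) λ ())
  ...   | inj₁ p₀≺p₁ = contradiction u≺v (<⇒≯ (InducedPath-rightwards peo p ind p₀≺p₁))
  ...   | inj₂ p₁≺p₀ = p (suc zero) , p₁≺p₀ , from (adj (suc zero) zero) (inj₂ refl)

  -- The left neighbour `u` ensures a parent. A child would be a second tree neighbour, equal to the
  -- parent by uniqueness, yet one precedes `v` and the other follows it.
  branchLeaf⇒childless : ∀ {u v} → u ≺[ σ ] v → u ~ v → Leaf (𝓛-tree G σ) v →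
    ∀ w → ¬ RightmostLeftNeighbour G σ w v
  branchLeaf⇒childless u≺v u~v (_ , _ , unique) w child@(v≺w , _)
    with p , parent@(p≺v , _) ← rightmostLeftNeighbour-exists u≺v u~v
    with refl ← trans (sym (unique (inj₁ parent))) (unique (inj₂ child)) = <⇒≯ p≺v v≺w

-- The two directions of the equivalence.

¬first⇒predecessor : (σ : Ordering n) {v : Fin n} → ¬ IsFirst σ v → ∃[ u ] u ≺[ σ ] v
¬first⇒predecessor {suc n} σ {v} ¬first =
  σ ⟨$⟩ʳ zero , subst (_<ᶠ (σ ⟨$⟩ˡ v)) (sym (inverseˡ σ)) (n≢0⇒n>0 ¬first)

branchLeaf⇒simplicial : (G : Graph n) (σ : Ordering n) → Connected G → PerfectEliminationOrdering G σ →
  ∀ {v} → 𝓛-BranchLeaf G σ v → Simplicial G v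
branchLeaf⇒simplicial G σ conn peo {v} (¬first , leaf) a b a~v b~v =
  peo v a b (left a~v , a~v) (left b~v , b~v)
  where
  open Graph G
  left : ∀ {a} → a ~ v → a ≺[ σ ] v
  left a~v with _ , u≺v ← ¬first⇒predecessor σ ¬first
    with _ , w≺v , w~v ← leftNeighbour-exists G σ conn peo u≺v
    with ≺-total G σ (λ a≡v → ~-irrefl a≡v a~v)
  ... | inj₁ a≺v = a≺v
  ... | inj₂ v≺a = contradiction v≺a
          (childless⇒last G σ peo (branchLeaf⇒childless G σ w≺v w~v leaf) (~-sym a~v))

-- Nothing comes after `v`, so it has no child, and its parent is its only tree neighbour.
▹-branchLeaf : (G : Graph (suc (suc n))) → Connected G → (σ : Ordering (suc n)) (v : Fin (suc (suc n))) →
  PerfectEliminationOrdering G (σ ▹ v) → 𝓛-BranchLeaf G (σ ▹ v) v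
▹-branchLeaf G conn σ v peo
  -- With at least two vertices, the last position is not position 0.
  with ¬first ← (λ first → contradiction (trans (sym (cong toℕ (▹-last σ v))) first) λ ())
  with _ , u≺v ← ¬first⇒predecessor (σ ▹ v) ¬first
  with _ , w≺v , w~v ← leftNeighbour-exists G (σ ▹ v) conn peo u≺v
  with p , parent ← rightmostLeftNeighbour-exists G (σ ▹ v) w≺v w~v
  = ¬first , p , inj₁ parent ,
    λ { (inj₁ parent′) → rightmostLeftNeighbour-unique G (σ ▹ v) parent parent′
      ; (inj₂ (v≺w , _)) → contradiction v≺w (▹-⊀ σ v _) }

simplicial⇒branchLeaf : (G : Graph n) → 2 ≤ n → Connected G → Chordal G → ∀ {v} → Simplicial G v →
  ∃[ σ ] (PerfectEliminationOrdering G σ × 𝓛-BranchLeaf G σ v)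
simplicial⇒branchLeaf G (s≤s (s≤s z≤n)) conn chordal {v} simplicial =
  let σ , peo = PEO-exists (G ∖ v) (∖-chordal G v chordal)
      peo′ = ▹-PEO G simplicial peo
  in σ ▹ v , peo′ , ▹-branchLeaf G conn σ v peo′

theorem9 : ∀ {n : ℕ} (G : Graph n) → 2 ≤ n → Connected G → Chordal G → (v : Fin n) →
    (∃[ σ ] (PerfectEliminationOrdering G σ × 𝓛-BranchLeaf G σ v)) ⇔ Simplicial G v
theorem9 G 2≤n conn chordal v = mk⇔
  (λ (σ , peo , leaf) → branchLeaf⇒simplicial G σ conn peo leaf)
  (simplicial⇒branchLeaf G 2≤n conn chordal)
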